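{- On the set of the $512$ mesh patterns $(12,R)$, $R\subseteq\{0,1,2\}\times\{0,1,2\}$, the equivalence relation of coincidence under $231$ (that is, $p_1\sim p_2$ if and only if $\mathrm{Av}(\{231,p_1\})=\mathrm{Av}(\{231,p_2\})$) has exactly $56$ equivalence classes.
   Context: Write $[n]=\{1,\dots,n\}$. A permutation of length $n$ is a bijection of $[n]$, written in one-line notation; $G(\pi)=\{(i,\pi(i)) : i\in[n]\}$ is its plot. A mesh pattern of length $k$ is a pair $p=(\tau,R)$ with $\tau$ a permutation of length $k$ and $R\subseteq\{0,\dots,k\}^2$. An occurrence of $p$ in a permutation $\pi$ of length $n$ is a subset $\omega\subseteq G(\pi)$ for which there are order-preserving injections $\alpha,\beta:[k]\to[n]$ such that (i) $\omega=\{(\alpha(i),\beta(j)):(i,j)\in G(\tau)\}$, and (ii) with $\alpha(0)=\beta(0)=0$, $\alpha(k+1)=\beta(k+1)=n+1$ and $R_{ij}=[\alpha(i)+1,\alpha(i+1)-1]\times[\beta(j)+1,\beta(j+1)-1]$, one has $R_{ij}\cap G(\pi)=\emptyset$ for every $(i,j)\in R$. A permutation avoids $p$ if it has no occurrence of $p$. A classical pattern $\pi$ is identified with the mesh pattern $(\pi,\emptyset)$. $\mathrm{Av}(S)$ is the set of all permutations (of all lengths, including the empty one) avoiding every pattern in $S$. -}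

module Defs where

open import Data.Fin using (Fin; suc; toℕ; fromℕ; inject₁; _≤_)
open import Data.Fin.Patterns using (0F; 1F; 2F)
open import Data.Fin.Permutation using (Permutation′; permutation; _⟨$⟩ʳ_)
  renaming (id to idₚ)
open import Data.Fin.Subset as Subset using (Subset)
open import Data.Nat using (ℕ; suc; _<_)
open import Data.Product using (Σ; Σ-syntax; ∃; ∃-syntax; _×_; _,_)
open import Data.Vec using (Vec; lookup; replicate)
import Data.Vec.Functional as VF
open import Function using (Injective)
open import Level using (0ℓ) renaming (suc to lsuc)
open import Relation.Binary using (Setoid; _Preserves_⟶_)
import Relation.Binary.Construct.On as On
open import Relation.Binary.PropositionalEquality using (_≡_; refl)
open import Relation.Nullary using (¬_)
open import Relation.Unary using (Pred; _∈_; _∉_; _⊆_; _≐_; _∪_; ｛_｝)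
open import Relation.Unary.Relation.Binary.Equality using (≐-setoid)

-- Element a of Fin n stands for suc (toℕ a) ∈ [n].

Perm : Set
Perm = Σ ℕ Permutation′

Points : ℕ → Set₁
Points n = Pred (Fin n × Fin n) 0ℓ

G : ∀ {n} → Permutation′ n → Points n
G π (i , v) = π ⟨$⟩ʳ i ≡ v

-- Subsets of {0,…,k}²: row i is the set of all j with (i , j) in the subset.
Shading : ℕ → Set
Shading k = Vec (Subset (suc k)) (suc k)

_∈ₛ_ : ∀ {k} → Fin (suc k) × Fin (suc k) → Shading k → Set
(i , j) ∈ₛ R = j Subset.∈ lookup R i

∅ₛ : ∀ {k} → Shading k
∅ₛ = replicate _ Subset.⊥

record MeshPattern : Set where
  constructor mesh
  field
    {k} : ℕ
    τ   : Permutation′ k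
    R   : Shading k

classical : ∀ {k} → Permutation′ k → MeshPattern
classical τ = mesh τ ∅ₛ

OrderPreservingInjection : ∀ {k n} → (Fin k → Fin n) → Set
OrderPreservingInjection α = Injective _≡_ _≡_ α × α Preserves _≤_ ⟶ _≤_

-- The sequence 0, α(1), …, α(k), n+1, with values in {0,…,n+1}.
extend : ∀ {k n} → (Fin k → Fin n) → Fin (suc (suc k)) → ℕ
extend {k} {n} α =
  0 VF.∷ VF.insertAt (λ i → suc (toℕ (α i))) (fromℕ k) (suc n)

-- α(i) < a < α(i+1), that is, a ∈ [α(i)+1, α(i+1)-1].
Between : ∀ {k n} → (Fin k → Fin n) → Fin (suc k) → Pred (Fin n) 0ℓ
Between α i a =
  extend α (inject₁ i) < suc (toℕ a) × suc (toℕ a) < extend α (suc i)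

Box : ∀ {k n} → (α β : Fin k → Fin n) → Fin (suc k) × Fin (suc k) → Points n
Box α β (i , j) (x , y) = x ∈ Between α i × y ∈ Between β j

image : ∀ {k n} → (α β : Fin k → Fin n) → Points k → Points n
image α β P z = ∃[ i ] ∃[ j ] ((i , j) ∈ P × (α i , β j) ≡ z)

IsOccurrence : ∀ {n} → MeshPattern → Permutation′ n → Points n → Set
IsOccurrence {n} (mesh {k} τ R) π ω =
  ω ⊆ G π ×
  (Σ[ α ∈ (Fin k → Fin n) ] Σ[ β ∈ (Fin k → Fin n) ]
    OrderPreservingInjection α × OrderPreservingInjection β ×
    ω ≐ image α β (G τ) ×
    (∀ c → c ∈ₛ R → ∀ z → z ∈ Box α β c → z ∉ G π))

Avoids : ∀ {n} → Permutation′ n → MeshPattern → Set₁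
Avoids π p = ¬ ∃ (IsOccurrence p π)

Av : Pred MeshPattern 0ℓ → Pred Perm (lsuc 0ℓ)
Av S (_ , π) = ∀ p → p ∈ S → Avoids π p

π₁₂ : Permutation′ 2
π₁₂ = idₚ

π₂₃₁ : Permutation′ 3
π₂₃₁ = permutation to from
  (λ { 0F → refl ; 1F → refl ; 2F → refl })
  (λ { 0F → refl ; 1F → refl ; 2F → refl })
  where
  to : Fin 3 → Fin 3
  to 0F = 1F
  to 1F = 2F
  to 2F = 0F

  from : Fin 3 → Fin 3
  from 0F = 2F
  from 1F = 0F
  from 2F = 1F

-- The patterns (12 , R), represented by R, where R₁ ≈ R₂ means
-- Av {σ , (12 , R₁)} ≐ Av {σ , (12 , R₂)}.
coincidence₁₂ : ∀ {m} → Permutation′ m → Setoid 0ℓ (lsuc 0ℓ)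
coincidence₁₂ σ =
  On.setoid (≐-setoid Perm (lsuc 0ℓ))
    (λ (R : Shading 2) → Av (｛ classical σ ｝ ∪ ｛ mesh π₁₂ R ｝))

{-# OPTIONS --safe #-}
module Submission where

-- A nonempty permutation avoiding 231 is l n r, where n is its greatest entry, l and r avoid 231
-- and every entry of l is below every entry of r.  Iterating this turns it into a binary tree.
-- In which boxes of a pair of points of l n r other points lie is determined by the boxes of
-- that pair inside l or r, or by the boxes of single points of l and r.  So whether (12 , R)
-- occurs is computed on the tree by a finite automaton, whose states combine nine types of single
-- point configurations with one bit.  Two shadings coincide once their automata agree on the
-- reachable states, and eight trees of at most five nodes separate the remaining 56 classes.

open import Defs
open import Data.Bool using (Bool; true; false; not; _∧_; _∨_) renaming (_≟_ to _≟ᵇ_)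
open import Data.Bool.Properties using (¬-not)
open import Data.Fin
  using (Fin; zero; suc; toℕ; fromℕ<; inject₁; _<_; _≤_; _<?_; _≟_; #_; splitAt; _↑ˡ_; _↑ʳ_)
open import Data.Fin.Patterns
open import Data.Fin.Permutation
  using (Permutation′; _⟨$⟩ʳ_; _⟨$⟩ˡ_; inverseˡ; inverseʳ; insert) renaming (id to idₚ)
open import Data.Fin.Properties
  using ( all?; *↔×; 2↔Bool; <-cmp; <-irrefl; <-trans; ≤-refl; ≤∧≢⇒<
        ; <-isStrictPartialOrder; toℕ<n; toℕ-fromℕ<; toℕ-injective )
open import Data.Fin.Subset using () renaming (⊥ to ⊥ₛ)
open import Data.List using (List; []; _∷_; map; deduplicate; tabulate) renaming (_++_ to _++ᴸ_)
open import Data.List.Membership.Propositional using (_∈_)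
open import Data.List.Relation.Unary.All as All using (All) renaming (all? to all?ᴸ)
open import Data.Nat using (ℕ; zero; suc; _^_; _+_; z≤n; s≤s) renaming (_≤_ to _≤ᴺ_; _<_ to _<ᴺ_)
import Data.Nat.Properties as ℕ
open import Data.Product using (Σ; ∃; ∃₂; _×_; _,_; proj₁; proj₂)
open import Data.Product.Function.NonDependent.Propositional using (_×-↔_)
open import Data.Product.Properties using (≡-dec)
open import Data.Sum using (_⊎_; inj₁; inj₂; [_,_]′)
open import Data.Vec using (Vec; []; _∷_; lookup)
open import Data.Vec.Properties using (lookup⇒[]=; []=⇒lookup; lookup-replicate)
open import Function using (_∘_)
open import Function.Bundles using (_↔_; _⇔_; mk⇔; mk↔ₛ′; Bijection; Equivalence; Inverse)
open import Function.Properties.Inverse using (↔-sym; ↔-trans)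
open import Level using (0ℓ)
open import Relation.Binary
  using (Rel; Setoid; DecidableEquality; IsStrictPartialOrder; tri<; tri≈; tri>)
open import Relation.Binary.PropositionalEquality
  using ( _≡_; _≢_; refl; sym; trans; cong; cong₂; subst; subst₂; resp₂; isEquivalence; setoid
        ; module ≡-Reasoning )
open import Relation.Nullary using (Dec; yes; no; ¬_; contradiction)
open import Relation.Nullary.Decidable using (True; map′; toWitness; _×-dec_; _→-dec_; ¬?)
open import Relation.Nullary.Reflects using (Reflects; ofʸ; ofⁿ; _×-reflects_; _⊎-reflects_)
open import Relation.Unary using (Pred; Decidable; Empty; U; _⊆_; _≐_; _∪_; ｛_｝)
open import Relation.Unary.Properties using (U?)

-- Binary trees and containment

data Tree : Set where
  ε   : Tree
  _▵_ : (l r : Tree) → Tree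

isEmpty : Tree → Bool
isEmpty ε       = true
isEmpty (_ ▵ _) = false

cell : ∀ {k} → Shading k → Fin (suc k) → Fin (suc k) → Bool
cell R x y = lookup (lookup R x) y

-- If the first point of a pair lies in `l` and the second does not, all of `l` is left of and below
-- the second point, so only the four lower left boxes concern `l`. Symmetrically, `upperRight`
-- serves `r` when the second point lies in `r`.
lowerLeft upperRight : Shading 2 → Shading 1
lowerLeft  ((a ∷ b ∷ _ ∷ []) ∷ (c ∷ d ∷ _ ∷ []) ∷ _ ∷ []) = (a ∷ b ∷ []) ∷ (c ∷ d ∷ []) ∷ []
upperRight (_ ∷ (_ ∷ a ∷ b ∷ []) ∷ (_ ∷ c ∷ d ∷ []) ∷ []) = (a ∷ b ∷ []) ∷ (c ∷ d ∷ []) ∷ []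

vacant : Tree → Bool → Bool
vacant t b = isEmpty t ∨ not b

-- The three cases place the point in l, at the root and in r.
contains₁ : Shading 1 → Tree → Bool
contains₁ P ε       = false
contains₁ P (l ▵ r) =
    (contains₁ P l ∧ not (cell P 1F 1F))
  ∨ (vacant l (cell P 0F 0F) ∧ vacant r (cell P 1F 0F))
  ∨ (contains₁ P r ∧ not (cell P 0F 1F) ∧ vacant l (cell P 0F 0F))

-- bl and br stand for the containment of (12 , R) in the two subtrees.
combine₂ : Shading 2 → Tree → Bool → Tree → Bool → Bool
combine₂ R l bl r br =
    (bl ∧ not (cell R 2F 2F))
  ∨ (br ∧ not (cell R 0F 2F) ∧ vacant l (cell R 0F 0F))
  ∨ (contains₁ (lowerLeft R) l ∧ vacant r (cell R 2F 1F))
  ∨ (contains₁ (lowerLeft R) l ∧ contains₁ (upperRight R) r ∧ not (cell R 1F 2F))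

contains₂ : Shading 2 → Tree → Bool
contains₂ R ε       = false
contains₂ R (l ▵ r) = combine₂ R l (contains₂ R l) r (contains₂ R r)

-- Enumeration of shadings.

vec↔Fin : ∀ {a m} {A : Set a} n → A ↔ Fin m → Vec A n ↔ Fin (m ^ n)
vec↔Fin zero    _ = mk↔ₛ′ (λ _ → 0F) (λ _ → []) (λ { zero → refl ; (suc ()) }) (λ { [] → refl })
vec↔Fin {m = m} {A} (suc n) A↔Fin =
  ↔-trans uncons↔ (↔-trans (A↔Fin ×-↔ vec↔Fin n A↔Fin) (↔-sym *↔×))
  where
  uncons↔ : Vec A (suc n) ↔ (A × Vec A n)
  uncons↔ = mk↔ₛ′ (λ { (x ∷ xs) → x , xs }) (λ (x , xs) → x ∷ xs) (λ _ → refl)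
                  (λ { (_ ∷ _) → refl })

shading↔Fin : ∀ k → Shading k ↔ Fin ((2 ^ suc k) ^ suc k)
shading↔Fin k = vec↔Fin (suc k) (vec↔Fin (suc k) (↔-sym 2↔Bool))

decode : ∀ k → Fin ((2 ^ suc k) ^ suc k) → Shading k
decode k = Inverse.from (shading↔Fin k)

-- Turns a claim about all shadings into one about `Fin`, which `all?` can settle by evaluation.
decode-surjective : ∀ {p k} {P : Shading k → Set p} → (∀ i → P (decode k i)) → ∀ R → P R
decode-surjective {k = k} {P} p R =
  subst P (Inverse.strictlyInverseʳ (shading↔Fin k) R) (p (Inverse.to (shading↔Fin k) R))

-- The automaton

-- This is everything `contains₁` and `combine₂` read off a subtree, so it is a congruence for `▵`.
record _≈_ (t u : Tree) : Set where
  constructor _,≈_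
  field
    isEmpty≡   : isEmpty t ≡ isEmpty u
    contains₁≡ : ∀ P → contains₁ P t ≡ contains₁ P u

▵-cong : ∀ {l l′ r r′} → l ≈ l′ → r ≈ r′ → (l ▵ r) ≈ (l′ ▵ r′)
▵-cong {l} {l′} {r} {r′} (el ,≈ pl) (er ,≈ pr) = refl ,≈ eq
  where
  eq : ∀ P → contains₁ P (l ▵ r) ≡ contains₁ P (l′ ▵ r′)
  eq P rewrite el | er | pl P | pr P = refl

_≈?_ : ∀ t u → Dec (t ≈ u)
t ≈? u = map′ (λ (e , p) → e ,≈ decode-surjective p) (λ (e ,≈ p) → e , p ∘ decode 1)
  (isEmpty t ≟ᵇ isEmpty u ×-dec
   all? λ i → contains₁ (decode 1 i) t ≟ᵇ contains₁ (decode 1 i) u)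

Kind : Set
Kind = Fin 9

• : Tree
• = ε ▵ ε

representative : Kind → Tree
representative = lookup
  ( ε
  ∷ •
  ∷ (ε ▵ •)
  ∷ (• ▵ ε)
  ∷ (ε ▵ (• ▵ ε))
  ∷ (• ▵ •)
  ∷ ((ε ▵ •) ▵ ε)
  ∷ ((ε ▵ •) ▵ •)
  ∷ (((ε ▵ •) ▵ ε) ▵ •)
  ∷ [] )

merge : Kind → Kind → Kind
merge i j = lookup (lookup table i) j
  where
  table : Vec (Vec Kind 9) 9
  table = (1F ∷ 2F ∷ 2F ∷ 4F ∷ 4F ∷ 4F ∷ 4F ∷ 4F ∷ 4F ∷ [])
        ∷ (3F ∷ 5F ∷ 5F ∷ 5F ∷ 5F ∷ 5F ∷ 5F ∷ 5F ∷ 5F ∷ [])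
        ∷ (6F ∷ 7F ∷ 7F ∷ 7F ∷ 7F ∷ 7F ∷ 7F ∷ 7F ∷ 7F ∷ [])
        ∷ (3F ∷ 5F ∷ 5F ∷ 5F ∷ 5F ∷ 5F ∷ 5F ∷ 5F ∷ 5F ∷ [])
        ∷ (6F ∷ 7F ∷ 7F ∷ 7F ∷ 7F ∷ 7F ∷ 7F ∷ 7F ∷ 7F ∷ [])
        ∷ (3F ∷ 5F ∷ 5F ∷ 5F ∷ 5F ∷ 5F ∷ 5F ∷ 5F ∷ 5F ∷ [])
        ∷ (6F ∷ 8F ∷ 8F ∷ 8F ∷ 8F ∷ 8F ∷ 8F ∷ 8F ∷ 8F ∷ [])
        ∷ (6F ∷ 7F ∷ 7F ∷ 7F ∷ 7F ∷ 7F ∷ 7F ∷ 7F ∷ 7F ∷ [])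
        ∷ (6F ∷ 8F ∷ 8F ∷ 8F ∷ 8F ∷ 8F ∷ 8F ∷ 8F ∷ 8F ∷ [])
        ∷ []

kind : Tree → Kind
kind ε       = 0F
kind (l ▵ r) = merge (kind l) (kind r)

-- A finite check of 81 products: the nine representatives include `ε` and are closed under `▵` up
-- to `≈`, so every tree is equivalent to one of them.
merge-correct : ∀ i j → (representative i ▵ representative j) ≈ representative (merge i j)
merge-correct = toWitness {a? = all? λ i → all? λ j →
  (representative i ▵ representative j) ≈? representative (merge i j)} _

≈-trans : ∀ {t u v} → t ≈ u → u ≈ v → t ≈ v
≈-trans (e ,≈ p) (e′ ,≈ p′) = trans e e′ ,≈ λ P → trans (p P) (p′ P)

≈-representative : ∀ t → t ≈ representative (kind t)
≈-representative ε       = refl ,≈ λ _ → refl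
≈-representative (l ▵ r) =
  ≈-trans (▵-cong (≈-representative l) (≈-representative r)) (merge-correct (kind l) (kind r))

State : Set
State = Kind × Bool

state : Shading 2 → Tree → State
state R t = kind t , contains₂ R t

step : Shading 2 → State → State → State
step R (i , b) (j , c) = merge i j , combine₂ R (representative i) b (representative j) c

combine₂-cong : ∀ R {l l′ r r′} b c → l ≈ l′ → r ≈ r′ → combine₂ R l b r c ≡ combine₂ R l′ b r′ c
combine₂-cong R b c (el ,≈ pl) (er ,≈ pr)
  rewrite el | er | pl (lowerLeft R) | pr (upperRight R) = refl

-- Replacing the subtrees by their representatives leaves `combine₂` unchanged, hence the state of a
-- tree is a function of the states of its two subtrees.
state-▵ : ∀ R l r → state R (l ▵ r) ≡ step R (state R l) (state R r)
state-▵ R l r = cong (kind (l ▵ r) ,_)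
  (combine₂-cong R (contains₂ R l) (contains₂ R r) (≈-representative l) (≈-representative r))

_≟ₛ_ : DecidableEquality State
_≟ₛ_ = ≡-dec _≟_ _≟ᵇ_

open import Data.List.Membership.DecPropositional _≟ₛ_ using (_∈?_)

-- Found by search: for every shading these trees realise all reachable states.
witnesses : List Tree
witnesses = tabulate representative ++ᴸ
   (((• ▵ ε) ▵ •) ▵ (• ▵ ε))
 ∷ ((((ε ▵ (• ▵ ε)) ▵ •) ▵ ε) ▵ ε)
 ∷ ((• ▵ •) ▵ ε)
 ∷ (ε ▵ (((ε ▵ •) ▵ •) ▵ •))
 ∷ ((ε ▵ (• ▵ ε)) ▵ (• ▵ ε))
 ∷ (((ε ▵ (• ▵ ε)) ▵ ε) ▵ (• ▵ ε))
 ∷ ((((ε ▵ •) ▵ ε) ▵ •) ▵ •)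
 ∷ ((((ε ▵ •) ▵ •) ▵ ε) ▵ •)
 ∷ ((• ▵ •) ▵ •)
 ∷ (((ε ▵ •) ▵ •) ▵ ε)
 ∷ (((ε ▵ •) ▵ •) ▵ •)
 ∷ ((((ε ▵ •) ▵ ε) ▵ ε) ▵ •)
 ∷ []

reachable : Shading 2 → List State
reachable R = deduplicate _≟ₛ_ (map (state R) witnesses)

-- `reachable` only collects states realised by `witnesses`. Containing the state of `ε` and being
-- stable under `step` certifies that no tree has a state outside the list.
Closed : Shading 2 → List State → Set
Closed R S = (0F , false) ∈ S × All (λ u → All (λ v → step R u v ∈ S) S) S

closed? : ∀ R S → Dec (Closed R S)
closed? R S =
  ((0F , false) ∈? S) ×-dec all?ᴸ (λ u → all?ᴸ (λ v → step R u v ∈? S) S) S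

-- The kind produced by `step` is independent of the shading, so comparing the bits compares the
-- whole states.
Agree : Shading 2 → Shading 2 → List State → Set
Agree R R′ S = All (λ u → All (λ v → proj₂ (step R′ u v) ≡ proj₂ (step R u v)) S) S

agree? : ∀ R R′ S → Dec (Agree R R′ S)
agree? R R′ S = all?ᴸ (λ u → all?ᴸ (λ v → proj₂ (step R′ u v) ≟ᵇ proj₂ (step R u v)) S) S

module _ {R R′ S} (closed : Closed R S) (agree : Agree R R′ S) where

  -- Both claims share one induction: `agree` applies at a node because the states of the subtrees
  -- lie in `S`. Closure is checked for `R` alone, as the states for `R′` turn out to be the same.
  states-agree : ∀ t → state R t ∈ S × state R′ t ≡ state R t
  states-agree ε       = proj₁ closed , refl
  states-agree (l ▵ r) with l∈S , l≡ ← states-agree l | r∈S , r≡ ← states-agree r =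
      subst (_∈ S) (sym (state-▵ R l r)) (All.lookup (All.lookup (proj₂ closed) l∈S) r∈S)
    , (begin
        state R′ (l ▵ r)                  ≡⟨ state-▵ R′ l r ⟩
        step R′ (state R′ l) (state R′ r) ≡⟨ cong₂ (step R′) l≡ r≡ ⟩
        step R′ (state R l) (state R r)   ≡⟨ cong (kind (l ▵ r) ,_)
                                               (All.lookup (All.lookup agree l∈S) r∈S) ⟩
        step R (state R l) (state R r)    ≡⟨ state-▵ R l r ⟨
        state R (l ▵ r)                   ∎)
    where open ≡-Reasoning

  contains₂-agree : ∀ t → contains₂ R′ t ≡ contains₂ R t
  contains₂-agree t = cong proj₂ (proj₂ (states-agree t))

-- Containment in a plot of a given shape

map-reflects : ∀ {a b} {A : Set a} {B : Set b} {x} → A ⇔ B → Reflects A x → Reflects B x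
map-reflects A⇔B (ofʸ  a) = ofʸ (Equivalence.to A⇔B a)
map-reflects A⇔B (ofⁿ ¬a) = ofⁿ (¬a ∘ Equivalence.from A⇔B)

≡false-reflects : ∀ b → Reflects (b ≡ false) (not b)
≡false-reflects true  = ofⁿ λ ()
≡false-reflects false = ofʸ refl

-- Gaps cut out of an order by one or two elements.

gap₁ : {A : Set} → Rel A 0ℓ → Fin 2 → A → Pred A 0ℓ
gap₁ _<_ 0F i k = k < i
gap₁ _<_ 1F i k = i < k

gap₂ : {A : Set} → Rel A 0ℓ → Fin 3 → A → A → Pred A 0ℓ
gap₂ _<_ 0F i j k = k < i
gap₂ _<_ 1F i j k = i < k × k < j
gap₂ _<_ 2F i j k = j < k

module Gaps {A : Set} {_<_ : Rel A 0ℓ} (isSPO : IsStrictPartialOrder _≡_ _<_) where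
  open IsStrictPartialOrder isSPO using (asym; irrefl) renaming (trans to transitive)

  gap₁-unique : ∀ x y {i k} → gap₁ _<_ x i k → gap₁ _<_ y i k → x ≡ y
  gap₁-unique 0F 0F _ _ = refl
  gap₁-unique 0F 1F p q = contradiction q (asym p)
  gap₁-unique 1F 0F p q = contradiction q (asym p)
  gap₁-unique 1F 1F _ _ = refl

  gap₂-unique : ∀ x y {i j k} → i < j → gap₂ _<_ x i j k → gap₂ _<_ y i j k → x ≡ y
  gap₂-unique 0F 0F _ _       _       = refl
  gap₂-unique 0F 1F _ p       (q , _) = contradiction q (asym p)
  gap₂-unique 0F 2F r p       q       = contradiction (transitive p r) (asym q)
  gap₂-unique 1F 0F _ (p , _) q       = contradiction q (asym p)
  gap₂-unique 1F 1F _ _       _       = refl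
  gap₂-unique 1F 2F _ (_ , p) q       = contradiction q (asym p)
  gap₂-unique 2F 0F r p       q       = contradiction (transitive q r) (asym p)
  gap₂-unique 2F 1F _ p       (_ , q) = contradiction q (asym p)
  gap₂-unique 2F 2F _ _       _       = refl

  gap₁-irrefl : ∀ x {i} → ¬ gap₁ _<_ x i i
  gap₁-irrefl 0F = irrefl refl
  gap₁-irrefl 1F = irrefl refl

  gap₂-irreflʳ : ∀ x {i j} → i < j → ¬ gap₂ _<_ x i j j
  gap₂-irreflʳ 0F r p       = asym r p
  gap₂-irreflʳ 1F _ (_ , p) = irrefl refl p
  gap₂-irreflʳ 2F _ p       = irrefl refl p

  -- For `k` below the second element the top gap is excluded, so the position of `k` relative to
  -- the pair is its position relative to the first element. The `suc` versions mirror this above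
  -- the first element.
  gap₁⇒gap₂-inject₁ : ∀ x {i j k} → k < j → gap₁ _<_ x i k → gap₂ _<_ (inject₁ x) i j k
  gap₁⇒gap₂-inject₁ 0F _ p = p
  gap₁⇒gap₂-inject₁ 1F q p = p , q

  gap₂⇒gap₁-inject₁ : ∀ x {i j k} → k < j → gap₂ _<_ x i j k →
                      ∃ λ y → x ≡ inject₁ y × gap₁ _<_ y i k
  gap₂⇒gap₁-inject₁ 0F _ p       = 0F , refl , p
  gap₂⇒gap₁-inject₁ 1F _ (p , _) = 1F , refl , p
  gap₂⇒gap₁-inject₁ 2F q p       = contradiction p (asym q)

  gap₁⇒gap₂-suc : ∀ x {i j k} → i < k → gap₁ _<_ x j k → gap₂ _<_ (suc x) i j k
  gap₁⇒gap₂-suc 0F q p = q , p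
  gap₁⇒gap₂-suc 1F _ p = p

  gap₂⇒gap₁-suc : ∀ x {i j k} → i < k → gap₂ _<_ x i j k →
                  ∃ λ y → x ≡ suc y × gap₁ _<_ y j k
  gap₂⇒gap₁-suc 0F q p       = contradiction p (asym q)
  gap₂⇒gap₁-suc 1F _ (_ , p) = 0F , refl , p
  gap₂⇒gap₁-suc 2F _ p       = 1F , refl , p

cell-lowerLeft : ∀ R x y → cell R (inject₁ x) (inject₁ y) ≡ cell (lowerLeft R) x y
cell-lowerLeft ((_ ∷ _ ∷ _ ∷ []) ∷ (_ ∷ _ ∷ _ ∷ []) ∷ _ ∷ []) = λ where
  0F 0F → refl
  0F 1F → refl
  1F 0F → refl
  1F 1F → refl

cell-upperRight : ∀ R x y → cell R (suc x) (suc y) ≡ cell (upperRight R) x y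
cell-upperRight (_ ∷ (_ ∷ _ ∷ _ ∷ []) ∷ (_ ∷ _ ∷ _ ∷ []) ∷ []) = λ where
  0F 0F → refl
  0F 1F → refl
  1F 0F → refl
  1F 1F → refl

-- A plot enters only through the orders of its points by position (≺) and by value (⊏).
module Plot {A : Set} {_≺_ _⊏_ : Rel A 0ℓ}
  (≺-isSPO : IsStrictPartialOrder _≡_ _≺_) (⊏-isSPO : IsStrictPartialOrder _≡_ _⊏_) where

  private
    module ≺ where
      open IsStrictPartialOrder ≺-isSPO public
      open Gaps ≺-isSPO public
    module ⊏ where
      open IsStrictPartialOrder ⊏-isSPO public
      open Gaps ⊏-isSPO public

  -- Quantifying over the boxes that hold `k` makes the condition vacuous for the points of an
  -- occurrence, which lie in no open gap. It can therefore be imposed on all of `B`.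
  Free₁ : Shading 1 → A → Pred A 0ℓ
  Free₁ P i k = ∀ x y → gap₁ _≺_ x i k → gap₁ _⊏_ y i k → cell P x y ≡ false

  Free₂ : Shading 2 → A → A → Pred A 0ℓ
  Free₂ R i j k = ∀ x y → gap₂ _≺_ x i j k → gap₂ _⊏_ y i j k → cell R x y ≡ false

  Occ₁ : Shading 1 → Pred A 0ℓ → Set
  Occ₁ P B = ∃ λ i → B i × B ⊆ Free₁ P i

  Occ₂ : Shading 2 → Pred A 0ℓ → Set
  Occ₂ R B = ∃₂ λ i j → B i × B j × i ≺ j × i ⊏ j × B ⊆ Free₂ R i j

  free₁ : ∀ P x y {i k} → gap₁ _≺_ x i k → gap₁ _⊏_ y i k → cell P x y ≡ false → Free₁ P i k
  free₁ P x y p q e x′ y′ p′ q′ =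
    trans (cong₂ (cell P) (≺.gap₁-unique x′ x p′ p) (⊏.gap₁-unique y′ y q′ q)) e

  free₂ : ∀ R x y {i j k} → i ≺ j → i ⊏ j → gap₂ _≺_ x i j k → gap₂ _⊏_ y i j k →
          cell R x y ≡ false → Free₂ R i j k
  free₂ R x y i≺j i⊏j p q e x′ y′ p′ q′ =
    trans (cong₂ (cell R) (≺.gap₂-unique x′ x i≺j p′ p) (⊏.gap₂-unique y′ y i⊏j q′ q)) e

  free₂-lowerLeft : ∀ R {i j k} → k ≺ j → k ⊏ j → Free₁ (lowerLeft R) i k → Free₂ R i j k
  free₂-lowerLeft R k≺j k⊏j f x y p q
    with x′ , refl , p′ ← ≺.gap₂⇒gap₁-inject₁ x k≺j p
       | y′ , refl , q′ ← ⊏.gap₂⇒gap₁-inject₁ y k⊏j q =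
    trans (cell-lowerLeft R x′ y′) (f x′ y′ p′ q′)

  free₁-lowerLeft : ∀ R {i j k} → k ≺ j → k ⊏ j → Free₂ R i j k → Free₁ (lowerLeft R) i k
  free₁-lowerLeft R k≺j k⊏j f x y p q = trans (sym (cell-lowerLeft R x y))
    (f _ _ (≺.gap₁⇒gap₂-inject₁ x k≺j p) (⊏.gap₁⇒gap₂-inject₁ y k⊏j q))

  free₂-upperRight : ∀ R {i j k} → i ≺ k → i ⊏ k → Free₁ (upperRight R) j k → Free₂ R i j k
  free₂-upperRight R i≺k i⊏k f x y p q
    with x′ , refl , p′ ← ≺.gap₂⇒gap₁-suc x i≺k p
       | y′ , refl , q′ ← ⊏.gap₂⇒gap₁-suc y i⊏k q =
    trans (cell-upperRight R x′ y′) (f x′ y′ p′ q′)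

  free₁-upperRight : ∀ R {i j k} → i ≺ k → i ⊏ k → Free₂ R i j k → Free₁ (upperRight R) j k
  free₁-upperRight R i≺k i⊏k f x y p q = trans (sym (cell-upperRight R x y))
    (f _ _ (≺.gap₁⇒gap₂-suc x i≺k p) (⊏.gap₁⇒gap₂-suc y i⊏k q))

  Vacant : Pred A 0ℓ → Bool → Set
  Vacant B b = Empty B ⊎ b ≡ false

  -- The decomposition at the highest point `m`. The field `l⊏r` is where avoidance of 231 enters: a
  -- point of `L`, then `m`, then a lower point of `R` would form 231.
  record Split (B L : Pred A 0ℓ) (m : A) (R : Pred A 0ℓ) : Set where
    field
      L⊆B   : L ⊆ B
      m∈B   : B m
      R⊆B   : R ⊆ B
      cover : ∀ {k} → B k → L k ⊎ m ≡ k ⊎ R k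
      l≺m   : ∀ {k} → L k → k ≺ m
      l⊏m   : ∀ {k} → L k → k ⊏ m
      m≺r   : ∀ {k} → R k → m ≺ k
      r⊏m   : ∀ {k} → R k → k ⊏ m
      l⊏r   : ∀ {i j} → L i → R j → i ⊏ j

    l≺r : ∀ {i j} → L i → R j → i ≺ j
    l≺r i∈L j∈R = ≺.trans (l≺m i∈L) (m≺r j∈R)

    split : ∀ {p} (Q : Pred A p) → L ⊆ Q → Q m → R ⊆ Q → B ⊆ Q
    split Q l⊆Q m∈Q r⊆Q k∈B with cover k∈B
    ... | inj₁ k∈L         = l⊆Q k∈L
    ... | inj₂ (inj₁ refl) = m∈Q
    ... | inj₂ (inj₂ k∈R)  = r⊆Q k∈R

  -- Shapes are assigned to subsets of one fixed plot, so the parts left and right of a root never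
  -- have to be renumbered as permutations.
  data Shape (B : Pred A 0ℓ) : Tree → Set₁ where
    empty : Empty B → Shape B ε
    node  : ∀ {L m R l r} → Split B L m R → Shape L l → Shape R r → Shape B (l ▵ r)

  Shape-resp-≐ : ∀ {B C t} → B ≐ C → Shape B t → Shape C t
  Shape-resp-≐ (_ , C⊆B) (empty ∅)      = empty λ k k∈C → ∅ k (C⊆B k∈C)
  Shape-resp-≐ (B⊆C , C⊆B) (node s l r) = node
    (record { Split s hiding (L⊆B ; m∈B ; R⊆B ; cover)
            ; L⊆B = B⊆C ∘ L⊆B ; m∈B = B⊆C m∈B ; R⊆B = B⊆C ∘ R⊆B ; cover = cover ∘ C⊆B }) l r
    where open Split s

  empty-reflects : ∀ {B t} → Shape B t → Reflects (Empty B) (isEmpty t)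
  empty-reflects (empty ∅)    = ofʸ ∅
  empty-reflects (node s _ _) = ofⁿ λ ∅ → ∅ _ (Split.m∈B s)

  vacant-reflects : ∀ {B t} → Shape B t → ∀ b → Reflects (Vacant B b) (vacant t b)
  vacant-reflects s b = empty-reflects s ⊎-reflects ≡false-reflects b

  -- The shape decides constructively whether `B` is empty, and otherwise supplies its root as a
  -- point to test.
  vacant! : ∀ {B t b} → Shape B t → (∀ {k} → B k → b ≡ false) → Vacant B b
  vacant! (empty ∅)    _ = inj₁ ∅
  vacant! (node s _ _) f = inj₂ (f (Split.m∈B s))

  vacant-elim : ∀ {B b k} → Vacant B b → B k → b ≡ false
  vacant-elim (inj₁ ∅) k∈B = contradiction k∈B (∅ _)
  vacant-elim (inj₂ e) _   = e

  module _ {B L m R l r} (s : Split B L m R) (shapeL : Shape L l) (shapeR : Shape R r) where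
    open Split s

    -- For a point in `L`, the root and all of `R` share its upper right box. The root always
    -- occupies that box, so it must be unshaded and `R` adds no further condition.
    Occ₁-node : Shading 1 → Set
    Occ₁-node P =
        (Occ₁ P L × cell P 1F 1F ≡ false)
      ⊎ (Vacant L (cell P 0F 0F) × Vacant R (cell P 1F 0F))
      ⊎ (Occ₁ P R × cell P 0F 1F ≡ false × Vacant L (cell P 0F 0F))

    Occ₁-split : ∀ P → Occ₁-node P ⇔ Occ₁ P B
    Occ₁-split P = mk⇔ join cut
      where
      join : Occ₁-node P → Occ₁ P B
      join (inj₁ ((i , i∈L , f) , e)) = i , L⊆B i∈L , split (Free₁ P i) f
        (free₁ P 1F 1F (l≺m i∈L) (l⊏m i∈L) e)
        (λ k∈R → free₁ P 1F 1F (l≺r i∈L k∈R) (l⊏r i∈L k∈R) e)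
      join (inj₂ (inj₁ (vL , vR))) = m , m∈B , split (Free₁ P m)
        (λ k∈L → free₁ P 0F 0F (l≺m k∈L) (l⊏m k∈L) (vacant-elim vL k∈L))
        (λ x _ p → contradiction p (≺.gap₁-irrefl x))
        (λ k∈R → free₁ P 1F 0F (m≺r k∈R) (r⊏m k∈R) (vacant-elim vR k∈R))
      join (inj₂ (inj₂ ((i , i∈R , f) , e , vL))) = i , R⊆B i∈R , split (Free₁ P i)
        (λ k∈L → free₁ P 0F 0F (l≺r k∈L i∈R) (l⊏r k∈L i∈R) (vacant-elim vL k∈L))
        (free₁ P 0F 1F (m≺r i∈R) (r⊏m i∈R) e)
        f

      cut : Occ₁ P B → Occ₁-node P
      cut (i , i∈B , f) with cover i∈B
      ... | inj₁ i∈L = inj₁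
        ((i , i∈L , f ∘ L⊆B) , f m∈B 1F 1F (l≺m i∈L) (l⊏m i∈L))
      ... | inj₂ (inj₁ refl) = inj₂ (inj₁
        ( vacant! shapeL (λ k∈L → f (L⊆B k∈L) 0F 0F (l≺m k∈L) (l⊏m k∈L))
        , vacant! shapeR (λ k∈R → f (R⊆B k∈R) 1F 0F (m≺r k∈R) (r⊏m k∈R))))
      ... | inj₂ (inj₂ i∈R) = inj₂ (inj₂
        ( (i , i∈R , f ∘ R⊆B)
        , f m∈B 0F 1F (m≺r i∈R) (r⊏m i∈R)
        , vacant! shapeL (λ k∈L → f (L⊆B k∈L) 0F 0F (l≺r k∈L i∈R) (l⊏r k∈L i∈R))))

    -- The pair lies in `L`, in `R`, in `L` and at the root, or across `L` and `R`. The root falls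
    -- in box (2,2), (0,2), none or (1,2) respectively; in the third case `R` fills only box (2,1).
    Occ₂-node : Shading 2 → Set
    Occ₂-node ρ =
        (Occ₂ ρ L × cell ρ 2F 2F ≡ false)
      ⊎ (Occ₂ ρ R × cell ρ 0F 2F ≡ false × Vacant L (cell ρ 0F 0F))
      ⊎ (Occ₁ (lowerLeft ρ) L × Vacant R (cell ρ 2F 1F))
      ⊎ (Occ₁ (lowerLeft ρ) L × Occ₁ (upperRight ρ) R × cell ρ 1F 2F ≡ false)

    Occ₂-split : ∀ ρ → Occ₂-node ρ ⇔ Occ₂ ρ B
    Occ₂-split ρ = mk⇔ join cut
      where
      join : Occ₂-node ρ → Occ₂ ρ B
      join (inj₁ ((i , j , i∈L , j∈L , i≺j , i⊏j , f) , e)) =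
        i , j , L⊆B i∈L , L⊆B j∈L , i≺j , i⊏j , split (Free₂ ρ i j) f
        (free₂ ρ 2F 2F i≺j i⊏j (l≺m j∈L) (l⊏m j∈L) e)
        (λ k∈R → free₂ ρ 2F 2F i≺j i⊏j (l≺r j∈L k∈R) (l⊏r j∈L k∈R) e)
      join (inj₂ (inj₁ ((i , j , i∈R , j∈R , i≺j , i⊏j , f) , e , vL))) =
        i , j , R⊆B i∈R , R⊆B j∈R , i≺j , i⊏j , split (Free₂ ρ i j)
        (λ k∈L → free₂ ρ 0F 0F i≺j i⊏j (l≺r k∈L i∈R) (l⊏r k∈L i∈R) (vacant-elim vL k∈L))
        (free₂ ρ 0F 2F i≺j i⊏j (m≺r i∈R) (r⊏m j∈R) e)
        f
      join (inj₂ (inj₂ (inj₁ ((i , i∈L , f) , vR)))) =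
        i , m , L⊆B i∈L , m∈B , l≺m i∈L , l⊏m i∈L , split (Free₂ ρ i m)
        (λ k∈L → free₂-lowerLeft ρ (l≺m k∈L) (l⊏m k∈L) (f k∈L))
        (λ x _ p → contradiction p (≺.gap₂-irreflʳ x (l≺m i∈L)))
        (λ k∈R → free₂ ρ 2F 1F (l≺m i∈L) (l⊏m i∈L) (m≺r k∈R) (l⊏r i∈L k∈R , r⊏m k∈R)
                   (vacant-elim vR k∈R))
      join (inj₂ (inj₂ (inj₂ ((i , i∈L , f) , (j , j∈R , g) , e)))) =
        i , j , L⊆B i∈L , R⊆B j∈R , l≺r i∈L j∈R , l⊏r i∈L j∈R , split (Free₂ ρ i j)
        (λ k∈L → free₂-lowerLeft ρ (l≺r k∈L j∈R) (l⊏r k∈L j∈R) (f k∈L))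
        (free₂ ρ 1F 2F (l≺r i∈L j∈R) (l⊏r i∈L j∈R) (l≺m i∈L , m≺r j∈R) (r⊏m j∈R) e)
        (λ k∈R → free₂-upperRight ρ (l≺r i∈L k∈R) (l⊏r i∈L k∈R) (g k∈R))

      cut : Occ₂ ρ B → Occ₂-node ρ
      cut (i , j , i∈B , j∈B , i≺j , i⊏j , f) with cover i∈B | cover j∈B
      ... | inj₁ i∈L | inj₁ j∈L = inj₁
        ((i , j , i∈L , j∈L , i≺j , i⊏j , f ∘ L⊆B) , f m∈B 2F 2F (l≺m j∈L) (l⊏m j∈L))
      ... | inj₁ i∈L | inj₂ (inj₁ refl) = inj₂ (inj₂ (inj₁
        ( (i , i∈L , λ k∈L → free₁-lowerLeft ρ (l≺m k∈L) (l⊏m k∈L) (f (L⊆B k∈L)))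
        , vacant! shapeR (λ k∈R → f (R⊆B k∈R) 2F 1F (m≺r k∈R) (l⊏r i∈L k∈R , r⊏m k∈R)))))
      ... | inj₁ i∈L | inj₂ (inj₂ j∈R) = inj₂ (inj₂ (inj₂
        ( (i , i∈L , λ k∈L → free₁-lowerLeft ρ (l≺r k∈L j∈R) (l⊏r k∈L j∈R) (f (L⊆B k∈L)))
        , (j , j∈R , λ k∈R → free₁-upperRight ρ (l≺r i∈L k∈R) (l⊏r i∈L k∈R) (f (R⊆B k∈R)))
        , f m∈B 1F 2F (l≺m i∈L , m≺r j∈R) (r⊏m j∈R))))
      -- No increasing pair starts at the root, which is highest, and none leads from `R` back to
      -- the root or to `L`, which lie further left.
      ... | inj₂ (inj₁ refl) | inj₁ j∈L         = contradiction (l≺m j∈L) (≺.asym i≺j)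
      ... | inj₂ (inj₁ refl) | inj₂ (inj₁ refl) = contradiction i≺j (≺.irrefl refl)
      ... | inj₂ (inj₁ refl) | inj₂ (inj₂ j∈R)  = contradiction (r⊏m j∈R) (⊏.asym i⊏j)
      ... | inj₂ (inj₂ i∈R)  | inj₁ j∈L         = contradiction (l≺r j∈L i∈R) (≺.asym i≺j)
      ... | inj₂ (inj₂ i∈R)  | inj₂ (inj₁ refl) = contradiction (m≺r i∈R) (≺.asym i≺j)
      ... | inj₂ (inj₂ i∈R)  | inj₂ (inj₂ j∈R)  = inj₂ (inj₁
        ( (i , j , i∈R , j∈R , i≺j , i⊏j , f ∘ R⊆B)
        , f m∈B 0F 2F (m≺r i∈R) (r⊏m j∈R)
        , vacant! shapeL (λ k∈L → f (L⊆B k∈L) 0F 0F (l≺r k∈L i∈R) (l⊏r k∈L i∈R))))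

  contains₁-reflects : ∀ {B t} → Shape B t → ∀ P → Reflects (Occ₁ P B) (contains₁ P t)
  contains₁-reflects (empty ∅)    P = ofⁿ λ (i , i∈B , _) → ∅ i i∈B
  contains₁-reflects (node s l r) P = map-reflects (Occ₁-split s l r P)
    (     (contains₁-reflects l P ×-reflects ≡false-reflects (cell P 1F 1F))
    ⊎-reflects (vacant-reflects l (cell P 0F 0F) ×-reflects vacant-reflects r (cell P 1F 0F))
    ⊎-reflects (contains₁-reflects r P ×-reflects ≡false-reflects (cell P 0F 1F)
                  ×-reflects vacant-reflects l (cell P 0F 0F)))

  contains₂-reflects : ∀ {B t} → Shape B t → ∀ R → Reflects (Occ₂ R B) (contains₂ R t)
  contains₂-reflects (empty ∅)    R = ofⁿ λ (i , _ , i∈B , _) → ∅ i i∈B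
  contains₂-reflects (node s l r) R = map-reflects (Occ₂-split s l r R)
    (     (contains₂-reflects l R ×-reflects ≡false-reflects (cell R 2F 2F))
    ⊎-reflects (contains₂-reflects r R ×-reflects ≡false-reflects (cell R 0F 2F)
                  ×-reflects vacant-reflects l (cell R 0F 0F))
    ⊎-reflects (contains₁-reflects l (lowerLeft R)
                  ×-reflects vacant-reflects r (cell R 2F 1F))
    ⊎-reflects (contains₁-reflects l (lowerLeft R)
                  ×-reflects contains₁-reflects r (upperRight R)
                  ×-reflects ≡false-reflects (cell R 1F 2F)))

-- Occurrences in permutations

StrictlyMonotone : ∀ {k n} → (Fin k → Fin n) → Set
StrictlyMonotone α = ∀ {x y} → x < y → α x < α y

strict⇒orderPreserving : ∀ {k n} {α : Fin k → Fin n} →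
                         StrictlyMonotone α → OrderPreservingInjection α
strict⇒orderPreserving {α = α} mono = injective , preserves
  where
  injective : ∀ {x y} → α x ≡ α y → x ≡ y
  injective {x} {y} e with <-cmp x y
  ... | tri< x<y _ _ = contradiction (mono x<y) (<-irrefl e)
  ... | tri≈ _ x≡y _ = x≡y
  ... | tri> _ _ y<x = contradiction (mono y<x) (<-irrefl (sym e))

  preserves : ∀ {x y} → x ≤ y → α x ≤ α y
  preserves {x} {y} x≤y with x ≟ y
  ... | yes refl = ≤-refl
  ... | no  x≢y  = ℕ.<⇒≤ (mono (≤∧≢⇒< x≤y x≢y))

orderPreserving⇒strict : ∀ {k n} {α : Fin k → Fin n} →
                         OrderPreservingInjection α → StrictlyMonotone α
orderPreserving⇒strict (injective , preserves) x<y =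
  ≤∧≢⇒< (preserves (ℕ.<⇒≤ x<y)) (λ e → <-irrefl (injective e) x<y)

-- The point set `ω` is dropped, since it can only be `image α β (G τ)`.
record Embedding {k n} (τ : Permutation′ k) (R : Shading k) (π : Permutation′ n) : Set where
  field
    α β    : Fin k → Fin n
    α-mono : StrictlyMonotone α
    β-mono : StrictlyMonotone β
    match  : ∀ i → π ⟨$⟩ʳ α i ≡ β (τ ⟨$⟩ʳ i)
    clear  : ∀ x y → cell R x y ≡ true → ∀ k → Between α x k → ¬ Between β y (π ⟨$⟩ʳ k)

occurrence⇔embedding : ∀ {k n} (τ : Permutation′ k) R (π : Permutation′ n) →
                       ∃ (IsOccurrence (mesh τ R) π) ⇔ Embedding τ R π
occurrence⇔embedding τ R π = mk⇔ to from
  where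
  to : ∃ (IsOccurrence (mesh τ R) π) → Embedding τ R π
  to (ω , ω⊆G , α , β , α-opi , β-opi , (_ , image⊆ω) , clear) = record
    { α = α ; β = β
    ; α-mono = orderPreserving⇒strict α-opi
    ; β-mono = orderPreserving⇒strict β-opi
    ; match  = λ i → ω⊆G (image⊆ω (i , τ ⟨$⟩ʳ i , refl , refl))
    ; clear  = λ x y e k p q →
        clear (x , y) (lookup⇒[]= y (lookup R x) e) (k , π ⟨$⟩ʳ k) (p , q) refl
    }

  from : Embedding τ R π → ∃ (IsOccurrence (mesh τ R) π)
  from e = image α β (G τ)
    , (λ { (i , _ , refl , refl) → match i })
    , α , β , strict⇒orderPreserving α-mono , strict⇒orderPreserving β-mono
    , ((λ z → z) , (λ z → z))
    , λ { (x , y) c∈R (k , _) (p , q) refl → clear x y ([]=⇒lookup c∈R) k p q }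
    where open Embedding e

-- Every element satisfies the bounds given by the end values 0 and n+1, which leaves the
-- inequalities of `gap₂`.
between⇔gap₂ : ∀ {n} (α : Fin 2 → Fin n) x {k} →
               Between α x k ⇔ gap₂ _<_ x (α 0F) (α 1F) k
between⇔gap₂ α 0F     = mk⇔ (λ { (_ , s≤s p) → p }) (λ p → s≤s z≤n , s≤s p)
between⇔gap₂ α 1F     = mk⇔ (λ { (s≤s p , s≤s q) → p , q }) (λ (p , q) → s≤s p , s≤s q)
between⇔gap₂ α 2F {k} = mk⇔ (λ { (s≤s p , _) → p }) (λ p → s≤s p , s≤s (toℕ<n k))

-- Avoidance of 231 as a condition on triples of positions.

231-Free : ∀ {n} → Permutation′ n → Set
231-Free π = ∀ i j k → i < j → j < k → ¬ (π ⟨$⟩ʳ k < π ⟨$⟩ʳ i × π ⟨$⟩ʳ i < π ⟨$⟩ʳ j)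

231-free? : ∀ {n} (π : Permutation′ n) → Dec (231-Free π)
231-free? π = all? λ i → all? λ j → all? λ k → i <? j →-dec j <? k →-dec
  ¬? (π ⟨$⟩ʳ k <? π ⟨$⟩ʳ i ×-dec π ⟨$⟩ʳ i <? π ⟨$⟩ʳ j)

avoids⇔231-Free : ∀ {n} (π : Permutation′ n) → Avoids π (classical π₂₃₁) ⇔ 231-Free π
avoids⇔231-Free {n} π = mk⇔
  (λ avoids i j k i<j j<k (πk<πi , πi<πj) → avoids (Equivalence.from embedding record
    { α      = triple i j k
    -- `β` lists the values in increasing order, and the last position carries the least one.
    ; β      = triple (π ⟨$⟩ʳ k) (π ⟨$⟩ʳ i) (π ⟨$⟩ʳ j)
    ; α-mono = triple-mono i<j j<k
    ; β-mono = triple-mono πk<πi πi<πj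
    ; match  = λ { 0F → refl ; 1F → refl ; 2F → refl }
    ; clear  = λ x y e → contradiction (trans (sym (cell-∅ₛ x y)) e) λ ()
    }))
  (λ free occ → let open Embedding (Equivalence.to embedding occ) in
    free (α 0F) (α 1F) (α 2F) (α-mono (s≤s z≤n)) (α-mono (s≤s (s≤s z≤n)))
      ( subst₂ _<_ (sym (match 2F)) (sym (match 0F)) (β-mono (s≤s z≤n))
      , subst₂ _<_ (sym (match 0F)) (sym (match 1F)) (β-mono (s≤s (s≤s z≤n)))))
  where
  embedding = occurrence⇔embedding π₂₃₁ ∅ₛ π

  triple : (i j k : Fin n) → Fin 3 → Fin n
  triple i j k = lookup (i ∷ j ∷ k ∷ [])

  triple-mono : ∀ {i j k} → i < j → j < k → StrictlyMonotone (triple i j k)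
  triple-mono i<j j<k {0F} {1F} _             = i<j
  triple-mono i<j j<k {0F} {2F} _             = <-trans i<j j<k
  triple-mono i<j j<k {1F} {2F} _             = j<k
  triple-mono i<j j<k {1F} {1F} (s≤s ())
  triple-mono i<j j<k {2F} {1F} (s≤s ())
  triple-mono i<j j<k {2F} {2F} (s≤s (s≤s ()))

  cell-∅ₛ : ∀ (x y : Fin 4) → cell ∅ₛ x y ≡ false
  cell-∅ₛ x y = trans (cong (λ v → lookup v y) (lookup-replicate x ⊥ₛ)) (lookup-replicate y false)

module _ {n} (π : Permutation′ n) where

  private
    _⊏_ : Rel (Fin n) 0ℓ
    i ⊏ j = π ⟨$⟩ʳ i < π ⟨$⟩ʳ j

    ⊏-isStrictPartialOrder : IsStrictPartialOrder _≡_ _⊏_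
    ⊏-isStrictPartialOrder = record
      { isEquivalence = isEquivalence
      ; irrefl        = λ { refl → <-irrefl refl }
      ; trans         = <-trans
      ; <-resp-≈      = resp₂ _⊏_
      }

  open Plot <-isStrictPartialOrder ⊏-isStrictPartialOrder public

  occurrence₁₂⇔Occ₂ : ∀ R → ∃ (IsOccurrence (mesh π₁₂ R) π) ⇔ Occ₂ R U
  occurrence₁₂⇔Occ₂ R = mk⇔ to from
    where
    to : ∃ (IsOccurrence (mesh π₁₂ R) π) → Occ₂ R U
    to occ = α 0F , α 1F , _ , _ , α-mono (s≤s z≤n)
      , subst₂ _<_ (sym (match 0F)) (sym (match 1F)) (β-mono (s≤s z≤n))
      , λ {k} _ x y p q → ¬-not λ e → clear x y e k
          (Equivalence.from (between⇔gap₂ α x) p)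
          (Equivalence.from (between⇔gap₂ β y)
            (subst₂ (λ i j → gap₂ _<_ y i j (π ⟨$⟩ʳ k)) (match 0F) (match 1F) (gap₂-on y q)))
      where
      open Embedding (Equivalence.to (occurrence⇔embedding π₁₂ R π) occ)
      -- `gap₂` reduces only for a concrete `y`; in each case the two sides are then the same
      -- inequalities.
      gap₂-on : ∀ y {i j k} → gap₂ _⊏_ y i j k → gap₂ _<_ y (π ⟨$⟩ʳ i) (π ⟨$⟩ʳ j) (π ⟨$⟩ʳ k)
      gap₂-on 0F p = p
      gap₂-on 1F p = p
      gap₂-on 2F p = p

    from : Occ₂ R U → ∃ (IsOccurrence (mesh π₁₂ R) π)
    from (i , j , _ , _ , i<j , i⊏j , free) = Equivalence.from (occurrence⇔embedding π₁₂ R π) record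
      { α      = pair
      ; β      = (π ⟨$⟩ʳ_) ∘ pair
      ; α-mono = λ { {0F} {1F} _ → i<j ; {1F} {1F} (s≤s ()) }
      ; β-mono = λ { {0F} {1F} _ → i⊏j ; {1F} {1F} (s≤s ()) }
      ; match  = λ _ → refl
      ; clear  = λ x y e k p q → contradiction
          (trans (sym (free {k} _ x y (Equivalence.to (between⇔gap₂ pair x) p)
                   (gap₂-on⁻¹ y (Equivalence.to (between⇔gap₂ ((π ⟨$⟩ʳ_) ∘ pair) y) q)))) e)
          λ ()
      }
      where
      pair : Fin 2 → Fin n
      pair = lookup (i ∷ j ∷ [])
      gap₂-on⁻¹ : ∀ y {i j k} → gap₂ _<_ y (π ⟨$⟩ʳ i) (π ⟨$⟩ʳ j) (π ⟨$⟩ʳ k) → gap₂ _⊏_ y i j k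
      gap₂-on⁻¹ 0F p = p
      gap₂-on⁻¹ 1F p = p
      gap₂-on⁻¹ 2F p = p

  avoids₁₂⇔ : ∀ {t} → Shape U t → ∀ R → Avoids π (mesh π₁₂ R) ⇔ contains₂ R t ≡ false
  avoids₁₂⇔ {t} shape R with contains₂ R t | contains₂-reflects shape R
  ... | true  | ofʸ  occ = mk⇔
    (λ avoids → contradiction (Equivalence.from (occurrence₁₂⇔Occ₂ R) occ) avoids) (λ ())
  ... | false | ofⁿ ¬occ = mk⇔ (λ _ → refl) (λ _ → ¬occ ∘ Equivalence.to (occurrence₁₂⇔Occ₂ R))

  -- Recursion on the bound v; the root of a nonempty set is its element of greatest value.
  shape-below : 231-Free π → ∀ v → v ≤ᴺ n → ∀ {B : Pred (Fin n) 0ℓ} → Decidable B →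
                ∃ λ t → Shape (λ k → B k × toℕ (π ⟨$⟩ʳ k) <ᴺ v) t
  shape-below free zero    _   B? = ε , empty λ { _ (_ , ()) }
  shape-below free (suc v) v<n {B} B? = case (B? m)
    where
    m : Fin n
    m = π ⟨$⟩ˡ fromℕ< v<n

    πm≡v : toℕ (π ⟨$⟩ʳ m) ≡ v
    πm≡v = trans (cong toℕ (inverseʳ π)) (toℕ-fromℕ< v<n)

    m≡ : ∀ {k} → toℕ (π ⟨$⟩ʳ k) ≡ v → m ≡ k
    m≡ {k} e = trans (cong (π ⟨$⟩ˡ_) (toℕ-injective (trans (toℕ-fromℕ< v<n) (sym e)))) (inverseˡ π)

    below : ∀ {k} → m ≢ k → toℕ (π ⟨$⟩ʳ k) <ᴺ suc v → toℕ (π ⟨$⟩ʳ k) <ᴺ v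
    below m≢k (s≤s p) = ℕ.≤∧≢⇒< p (m≢k ∘ m≡)

    under : ∀ {k} → toℕ (π ⟨$⟩ʳ k) <ᴺ v → k ⊏ m
    under {k} = subst (toℕ (π ⟨$⟩ʳ k) <ᴺ_) (sym πm≡v)

    case : Dec (B m) → ∃ λ t → Shape (λ k → B k × toℕ (π ⟨$⟩ʳ k) <ᴺ suc v) t
    -- The position of value `v` is not in `B`, so lowering the bound removes no point.
    case (no m∉B) with t , s ← shape-below free v (ℕ.<⇒≤ v<n) B? = t , Shape-resp-≐
      ( (λ (k∈B , k<v) → k∈B , ℕ.m<n⇒m<1+n k<v)
      , (λ (k∈B , k<v) → k∈B , below (λ { refl → m∉B k∈B }) k<v)) s
    case (yes m∈B)
      with l , sl ← shape-below free v (ℕ.<⇒≤ v<n) (λ k → B? k ×-dec k <? m)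
         | r , sr ← shape-below free v (ℕ.<⇒≤ v<n) (λ k → B? k ×-dec m <? k) =
      l ▵ r , node (record
        { L⊆B   = λ ((k∈B , _) , k<v) → k∈B , ℕ.m<n⇒m<1+n k<v
        ; m∈B   = m∈B , s≤s (ℕ.≤-reflexive πm≡v)
        ; R⊆B   = λ ((k∈B , _) , k<v) → k∈B , ℕ.m<n⇒m<1+n k<v
        ; cover = cover
        ; l≺m   = λ ((_ , k<m) , _) → k<m
        ; l⊏m   = λ (_ , k<v) → under k<v
        ; m≺r   = λ ((_ , m<k) , _) → m<k
        ; r⊏m   = λ (_ , k<v) → under k<v
        ; l⊏r   = l⊏r
        }) sl sr
      where
      cover : ∀ {k} → B k × toℕ (π ⟨$⟩ʳ k) <ᴺ suc v →
              ((B k × k < m) × toℕ (π ⟨$⟩ʳ k) <ᴺ v) ⊎ m ≡ k ⊎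
              ((B k × m < k) × toℕ (π ⟨$⟩ʳ k) <ᴺ v)
      cover {k} (k∈B , p) with <-cmp k m
      ... | tri< k<m k≢m _ = inj₁ ((k∈B , k<m) , below (k≢m ∘ sym) p)
      ... | tri≈ _ k≡m _   = inj₂ (inj₁ (sym k≡m))
      ... | tri> _ k≢m m<k = inj₂ (inj₂ ((k∈B , m<k) , below (k≢m ∘ sym) p))

      l⊏r : ∀ {i j} → (B i × i < m) × toℕ (π ⟨$⟩ʳ i) <ᴺ v →
            (B j × m < j) × toℕ (π ⟨$⟩ʳ j) <ᴺ v → i ⊏ j
      l⊏r {i} {j} ((_ , i<m) , i<v) ((_ , m<j) , _) with <-cmp (π ⟨$⟩ʳ i) (π ⟨$⟩ʳ j)
      ... | tri< i⊏j _ _ = i⊏j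
      ... | tri≈ _ e _   = contradiction (<-trans i<m m<j)
        (<-irrefl (trans (sym (inverseˡ π)) (trans (cong (π ⟨$⟩ˡ_) e) (inverseˡ π))))
      -- `m` has value `v`, which exceeds the values at `i` and `j`, so `i`, `m`, `j` would form
      -- 231.
      ... | tri> _ _ j⊏i = contradiction (j⊏i , under i<v) (free i m j i<m m<j)

  shape : 231-Free π → ∃ λ t → Shape U t
  shape free with t , s ← shape-below free n ℕ.≤-refl U? = t , Shape-resp-≐
    ((λ _ → _) , (λ {k} _ → _ , toℕ<n (π ⟨$⟩ʳ k))) s

-- Coincidence and agreement on trees.

_≋_ : Rel (Shading 2) _
_≋_ = Setoid._≈_ (coincidence₁₂ π₂₃₁)

-- A permutation avoiding 231 has a shape `t`, and by `avoids₁₂⇔` whether it avoids the mesh pattern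
-- depends on `t` only.
agree⇒coincide : ∀ R₁ R₂ → (∀ t → contains₂ R₁ t ≡ contains₂ R₂ t) → R₁ ≋ R₂
agree⇒coincide R₁ R₂ agree =
  (λ {π} → include R₁ R₂ agree {π}) , (λ {π} → include R₂ R₁ (sym ∘ agree) {π})
  where
  include : ∀ R₁ R₂ → (∀ t → contains₂ R₁ t ≡ contains₂ R₂ t) →
            Av (｛ classical π₂₃₁ ｝ ∪ ｛ mesh π₁₂ R₁ ｝) ⊆ Av (｛ classical π₂₃₁ ｝ ∪ ｛ mesh π₁₂ R₂ ｝)
  include _ _ agree {_ , π} avoids _ (inj₁ refl) = avoids _ (inj₁ refl)
  include R₁ R₂ agree {_ , π} avoids _ (inj₂ refl)
    with t , s ← shape π (Equivalence.to (avoids⇔231-Free π) (avoids _ (inj₁ refl))) =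
    Equivalence.from (avoids₁₂⇔ π s R₂) (trans (sym (agree t))
      (Equivalence.to (avoids₁₂⇔ π s R₁) (avoids _ (inj₂ refl))))

Realised : Tree → Set₁
Realised t = ∃ λ n → Σ (Permutation′ n) λ π → 231-Free π × Shape π U t

-- The tree is computed by `shape`, so each use at a stated tree is verified by evaluation.
realise : ∀ {n} (π : Permutation′ n) {free : True (231-free? π)} →
          Realised (proj₁ (shape π (toWitness free)))
realise π {free} = _ , π , toWitness free , proj₂ (shape π (toWitness free))

coincide⇒agree : ∀ R₁ R₂ {t} → Realised t → R₁ ≋ R₂ → contains₂ R₁ t ≡ contains₂ R₂ t
coincide⇒agree R₁ R₂ {t} (_ , π , free , s) (⊆₁₂ , ⊆₂₁) =
  iff⇒≡ (transfer R₁ R₂ λ {π} → ⊆₁₂ {π}) (transfer R₂ R₁ λ {π} → ⊆₂₁ {π})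
  where
  iff⇒≡ : ∀ {b c} → (b ≡ false → c ≡ false) → (c ≡ false → b ≡ false) → b ≡ c
  iff⇒≡ {true}  {true}  _ _ = refl
  iff⇒≡ {true}  {false} _ g = g refl
  iff⇒≡ {false} {true}  f _ = sym (f refl)
  iff⇒≡ {false} {false} _ _ = refl

  transfer : ∀ R R′ →
    Av (｛ classical π₂₃₁ ｝ ∪ ｛ mesh π₁₂ R ｝) ⊆ Av (｛ classical π₂₃₁ ｝ ∪ ｛ mesh π₁₂ R′ ｝) →
    contains₂ R t ≡ false → contains₂ R′ t ≡ false
  transfer R R′ ⊆′ e = Equivalence.to (avoids₁₂⇔ π s R′) (⊆′ {_ , π} avoids _ (inj₂ refl))
    where
    avoids : ∀ p → _ → Avoids π p
    avoids _ (inj₁ refl) = Equivalence.from (avoids⇔231-Free π) free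
    avoids _ (inj₂ refl) = Equivalence.from (avoids₁₂⇔ π s R) e

-- The 56 classes

-- The shapes of 312, 132, 213, 1324, 1243, 2134, 15324 and 41325, in this order.
samples : Vec Tree 8
samples =
    (ε ▵ (• ▵ ε))
  ∷ (• ▵ •)
  ∷ ((ε ▵ •) ▵ ε)
  ∷ ((• ▵ •) ▵ ε)
  ∷ ((• ▵ ε) ▵ •)
  ∷ (((ε ▵ •) ▵ ε) ▵ ε)
  ∷ (• ▵ ((ε ▵ •) ▵ ε))
  ∷ ((ε ▵ (• ▵ •)) ▵ ε)
  ∷ []

infixr 5 _◂_
-- Prepends an entry by its rank, so a chain of `◂` spells the Lehmer code of a permutation.
_◂_ : ∀ {n} → Fin (suc n) → Permutation′ n → Permutation′ (suc n)
_◂_ = insert 0F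

samples-realised : ∀ i → Realised (lookup samples i)
samples-realised 0F = realise (2F ◂ 0F ◂ 0F ◂ idₚ {0})
samples-realised 1F = realise (0F ◂ 1F ◂ 0F ◂ idₚ {0})
samples-realised 2F = realise (1F ◂ 0F ◂ 0F ◂ idₚ {0})
samples-realised 3F = realise (0F ◂ 1F ◂ 0F ◂ 0F ◂ idₚ {0})
samples-realised 4F = realise (0F ◂ 0F ◂ 1F ◂ 0F ◂ idₚ {0})
samples-realised 5F = realise (1F ◂ 0F ◂ 0F ◂ 0F ◂ idₚ {0})
samples-realised 6F = realise (0F ◂ 3F ◂ 1F ◂ 0F ◂ 0F ◂ idₚ {0})
samples-realised 7F = realise (3F ◂ 0F ◂ 1F ◂ 0F ◂ 0F ◂ idₚ {0})

-- A decision tree: `ask i c d` continues with `d` if sample `i` contains the pattern and with `c`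
-- otherwise. A leaf stores the index of a shading that represents its class.
data Classifier : Set where
  leaf : Fin 512 → Classifier
  ask  : Fin 8 → Classifier → Classifier → Classifier

size : Classifier → ℕ
size (leaf _)    = 1
size (ask _ c d) = size c + size d

classify : ∀ c → Shading 2 → Fin (size c)
classify (leaf _)    R = 0F
classify (ask i c d) R with contains₂ R (lookup samples i)
... | false = classify c R ↑ˡ size d
... | true  = size c ↑ʳ classify d R

canonical : ∀ c → Fin (size c) → Shading 2
canonical (leaf i)    _ = decode 2 i
canonical (ask _ c d) k = [ canonical c , canonical d ]′ (splitAt (size c) k)

classify-cong : ∀ c R₁ R₂ → R₁ ≋ R₂ → classify c R₁ ≡ classify c R₂
classify-cong (leaf _)    _  _  _  = refl
classify-cong (ask i c d) R₁ R₂ R₁≋R₂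
  with contains₂ R₁ (lookup samples i) | contains₂ R₂ (lookup samples i)
     | coincide⇒agree R₁ R₂ (samples-realised i) R₁≋R₂
... | false | false | refl = cong (_↑ˡ size d) (classify-cong c R₁ R₂ R₁≋R₂)
... | true  | true  | refl = cong (size c ↑ʳ_) (classify-cong d R₁ R₂ R₁≋R₂)

-- The nine binary digits of a leaf index describe the boxes (0,0), (0,1), ..., (2,2) in this order,
-- with 1 for shaded. The checks below certify the choice of questions and leaves.
classifier : Classifier
classifier =
  (ask 0F
   (ask 1F
    (ask 4F
     (ask 2F
      (ask 3F
       (ask 5F (leaf (# 507)) (leaf (# 251)))
       (ask 5F (leaf (# 491)) (leaf (# 235))))
      (ask 3F
       (ask 7F (leaf (# 379)) (leaf (# 347)))
       (leaf (# 75))))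
     (ask 2F
      (ask 3F
       (ask 5F (leaf (# 506)) (leaf (# 250)))
       (ask 5F (leaf (# 490)) (leaf (# 234))))
      (ask 3F
       (ask 7F (leaf (# 378)) (leaf (# 346)))
       (leaf (# 74)))))
    (ask 2F
     (ask 5F
      (ask 3F
       (ask 6F (leaf (# 499)) (leaf (# 497)))
       (leaf (# 480)))
      (ask 3F
       (ask 6F (leaf (# 243)) (leaf (# 241)))
       (leaf (# 224))))
     (ask 3F
      (ask 6F
       (ask 7F (leaf (# 371)) (leaf (# 339)))
       (ask 7F (leaf (# 369)) (leaf (# 337))))
      (ask 6F
       (leaf (# 83))
       (ask 7F (leaf (# 368)) (leaf (# 64)))))))
   (ask 4F
    (ask 1F
     (ask 2F
      (ask 3F
       (ask 5F (leaf (# 443)) (leaf (# 187)))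
       (ask 5F (leaf (# 427)) (leaf (# 171))))
      (ask 3F
       (ask 7F (leaf (# 315)) (leaf (# 283)))
       (ask 6F (leaf (# 267)) (leaf (# 11)))))
     (ask 6F
      (ask 2F
       (leaf (# 435))
       (ask 7F (leaf (# 307)) (leaf (# 275))))
      (ask 2F
       (leaf (# 433))
       (ask 7F (leaf (# 305)) (leaf (# 273))))))
    (ask 1F
     (ask 2F
      (ask 3F
       (ask 5F (leaf (# 442)) (leaf (# 186)))
       (ask 5F (leaf (# 426)) (leaf (# 170))))
      (ask 3F
       (ask 7F (leaf (# 314)) (leaf (# 282)))
       (ask 6F (leaf (# 266)) (leaf (# 10)))))
     (ask 7F
      (ask 3F
       (ask 6F (leaf (# 179)) (leaf (# 177)))
       (ask 5F (leaf (# 417)) (leaf (# 161))))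
      (ask 2F
       (ask 5F (leaf (# 416)) (leaf (# 160)))
       (leaf (# 0)))))))

-- The type checks because `size classifier` evaluates to 56.
class : Shading 2 → Fin 56
class = classify classifier

-- Each representative is sorted back to its own leaf, so all 56 leaves are attained and, by
-- `classify-cong`, no two representatives coincide.
canonical-class : ∀ k → class (canonical classifier k) ≡ k
canonical-class = toWitness {a? = all? λ k → class (canonical classifier k) ≟ k} _

canonical-closed : ∀ k → let R = canonical classifier k in Closed R (reachable R)
canonical-closed = toWitness
  {a? = all? λ k → let R = canonical classifier k in closed? R (reachable R)} _

-- All 512 shadings are compared with the representative of their leaf on its reachable states. With
-- `canonical-closed` this extends to all trees, so the eight samples miss no coincidence.
canonical-agree : ∀ R → let R₀ = canonical classifier (class R) in Agree R₀ R (reachable R₀)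
canonical-agree = decode-surjective (toWitness
  {a? = all? λ i → let R = decode 2 i ; R₀ = canonical classifier (class R) in
                   agree? R₀ R (reachable R₀)} _)

≋-canonical : ∀ R → R ≋ canonical classifier (class R)
≋-canonical R = agree⇒coincide R (canonical classifier (class R))
  (contains₂-agree (canonical-closed (class R)) (canonical-agree R))

class-injective : ∀ R₁ R₂ → class R₁ ≡ class R₂ → R₁ ≋ R₂
class-injective R₁ R₂ e = ≋.trans {R₁} {R₀} {R₂} (≋-canonical R₁)
  (≋.sym {R₂} {R₀} (subst (λ k → R₂ ≋ canonical classifier k) (sym e) (≋-canonical R₂)))
  where
  module ≋ = Setoid (coincidence₁₂ π₂₃₁)
  R₀ = canonical classifier (class R₁)

-- A bijection from the setoid of shadings under coincidence to `Fin 56` counts the classes; the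
-- first component counts the patterns.
mainTheorem6 : (Shading 2 ↔ Fin 512) × Bijection (coincidence₁₂ π₂₃₁) (setoid (Fin 56))
mainTheorem6 = shading↔Fin 2 , record
  { to        = class
  ; cong      = λ {R₁} {R₂} → classify-cong classifier R₁ R₂
  ; bijective =
      (λ {R₁} {R₂} → class-injective R₁ R₂)
    , λ k → canonical classifier k , λ {R} R≋ →
        trans (classify-cong classifier R (canonical classifier k) R≋) (canonical-class k)
  }
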